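{- Let $n\in\mathbb{N}$. For every $m\in\mathbb{N}_0$ and every subset $J\subseteq\mathcal{Z}_n$ (possibly empty) one has $$\mathcal{E}_m(J)=\begin{cases}(-1)^{m}\mathcal{H}_{m}(\mathcal{Z}_n\setminus J)+(-1)^{m-1}\mathcal{H}_{m-n}(\mathcal{Z}_n\setminus J) & \text{if } n\le m,\\ (-1)^{m}\mathcal{H}_{m}(\mathcal{Z}_n\setminus J) & \text{otherwise.}\end{cases}$$
   Context: $\mathbb{N}=\{1,2,\ldots\}$, $\mathbb{N}_0=\mathbb{N}\cup\{0\}$. $\zeta_n:=e^{2\pi i/n}$ and $\mathcal{Z}_n:=\{1,\zeta_n,\ldots,\zeta_n^{n-1}\}$ is the set of $n$th roots of unity in $\mathbb{C}$. For a finite nonempty set $A=\{z_1,\ldots,z_r\}$ of complex numbers, the elementary symmetric polynomials are $\mathcal{E}_0(A):=1$, $\mathcal{E}_m(A):=\sum_{1\le j_1<\cdots<j_m\le r}z_{j_1}\cdots z_{j_m}$ for $1\le m\le r$, $\mathcal{E}_m(A):=0$ for $m>r$; the complete homogeneous symmetric polynomials are $\mathcal{H}_0(A):=1$ and $\mathcal{H}_m(A):=\sum_{1\le j_1\le\cdots\le j_m\le r}z_{j_1}\cdots z_{j_m}$ for $m\ge1$. Convention: $\mathcal{H}_m(\emptyset)=\mathcal{E}_m(\emptyset):=1$ if $m=0$ and $:=0$ otherwise. -}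

module Defs where

open import Level using (suc; _⊔_)
open import Algebra.Apartness.Bundles using (HeytingField)
open import Algebra.Bundles using (CommutativeRing; Semiring)
import Algebra.Definitions.RawSemiring as RawSemiringDefs
open import Data.Fin.Base using (Fin; toℕ)
open import Data.Integer.Base using (ℤ; +_; -[1+_])
open import Data.List.Base using (List; []; _∷_; _++_; map; foldr)
import Data.List.Membership.Setoid as Membership
import Data.List.Relation.Unary.Unique.Setoid as Uniqueness
open import Data.Nat.Base as ℕ using (ℕ; NonZero)
open import Data.Product.Base using (∃-syntax; proj₁)
open import Function.Bundles using (_⇔_)
open import Relation.Unary using (Pred)

module FieldNotation {c ℓ₁ ℓ₂} (F : HeytingField c ℓ₁ ℓ₂) where
  open HeytingField F public

  commutativeRing : CommutativeRing c ℓ₁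
  commutativeRing = record { isCommutativeRing = isCommutativeRing }

  open RawSemiringDefs
    (Semiring.rawSemiring (CommutativeRing.semiring commutativeRing)) public
    using (_^_) renaming (_×_ to infixr 8 _×ℕ_)

  infixr 8 _×ℤ_
  _×ℤ_ : ℤ → Carrier → Carrier
  (+ n)    ×ℤ z = n ×ℕ z
  -[1+ n ] ×ℤ z = - (ℕ.suc n ×ℕ z)

-- The library has no complex numbers. What follows is developed over an
-- arbitrary field of characteristic zero carrying an imaginary unit, a
-- number π and an exponential map with the usual addition law and with
-- kernel 2πiℤ. The complex numbers, with their ordinary i, π and exp, are
-- such a structure. The apartness of a Heyting field covers both the
-- constructive ℂ and, with _#_ read as _≉_, the classical one.
record ComplexNumbers c ℓ₁ ℓ₂ : Set (suc (c ⊔ ℓ₁ ⊔ ℓ₂)) where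
  field
    heytingField : HeytingField c ℓ₁ ℓ₂

  open FieldNotation heytingField public

  field
    char0 : ∀ n .{{_ : NonZero n}} → n ×ℕ 1# # 0#
    i     : Carrier
    i²≈-1 : i * i ≈ - 1#
    π     : Carrier
    π#0   : π # 0#

  2πi : Carrier
  2πi = 2 ×ℕ (π * i)

  field
    exp        : Carrier → Carrier
    exp-cong   : ∀ {z w} → z ≈ w → exp z ≈ exp w
    exp-+      : ∀ z w → exp (z + w) ≈ exp z * exp w
    exp-kernel : ∀ z → exp z ≈ 1# ⇔ (∃[ k ] z ≈ k ×ℤ 2πi)

  1/_ : ∀ n .{{_ : NonZero n}} → Carrier
  1/ n = proj₁ (#⇒invertible (char0 n))

module _ {a} {A : Set a} where

  -- The tuples (z_{j₁}, …, z_{jₘ}) with j₁ < ⋯ < jₘ, split according to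
  -- whether or not j₁ is the first index.
  increasing : ℕ → List A → List (List A)
  increasing ℕ.zero    _        = [] ∷ []
  increasing (ℕ.suc m) []       = []
  increasing (ℕ.suc m) (z ∷ zs) =
    map (z ∷_) (increasing m zs) ++ increasing (ℕ.suc m) zs

  -- The same with j₁ ≤ ⋯ ≤ jₘ: the first index stays available.
  nondecreasing : ℕ → List A → List (List A)
  nondecreasing ℕ.zero    _        = [] ∷ []
  nondecreasing (ℕ.suc m) []       = []
  nondecreasing (ℕ.suc m) (z ∷ zs) =
    map (z ∷_) (nondecreasing m (z ∷ zs)) ++ nondecreasing (ℕ.suc m) zs

module Symmetric {c ℓ₁ ℓ₂} (ℂ : ComplexNumbers c ℓ₁ ℓ₂) where
  open ComplexNumbers ℂ
  open Membership setoid using (_∈_)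
  open Uniqueness setoid using (Unique)

  ζ : ∀ n .{{_ : NonZero n}} → Carrier
  ζ n = exp (2πi * 1/ n)

  𝒵 : ∀ n .{{_ : NonZero n}} → Pred Carrier ℓ₁
  𝒵 n z = ∃[ k ] z ≈ ζ n ^ toℕ {n} k

  -- A finite set {z₁, …, zᵣ} is given by an enumeration without repetition.
  record FiniteSet : Set (c ⊔ ℓ₁) where
    constructor finiteSet
    field
      elements : List Carrier
      distinct : Unique elements

  open FiniteSet public

  ⟦_⟧ : FiniteSet → Pred Carrier (c ⊔ ℓ₁)
  ⟦ A ⟧ z = z ∈ elements A

  sum : List Carrier → Carrier
  sum = foldr _+_ 0#

  product : List Carrier → Carrier
  product = foldr _*_ 1#

  ℰ : ℕ → FiniteSet → Carrier
  ℰ m A = sum (map product (increasing m (elements A)))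

  ℋ : ℕ → FiniteSet → Carrier
  ℋ m A = sum (map product (nondecreasing m (elements A)))

-- The generating functions are E_J(-t) = ∏_{z ∈ J} (1 - z t) and
-- H_{Jᶜ}(t) = ∏_{z ∈ Jᶜ} (1 - z t)⁻¹, so ∏_{z ∈ 𝒵 n} (1 - z t) = 1 - tⁿ gives
-- E_J(-t) = (1 - tⁿ) H_{Jᶜ}(t), whose coefficients are the claim. The product
-- P(t) over 𝒵 n is found without factoring tⁿ - 1: it is unchanged by t ↦ ζ t,
-- so only its coefficients at 1 and tⁿ survive, and P(1) = 0 fixes the latter.

module Submission where

open import Defs
open import Algebra.Bundles using (CommutativeRing; Semiring)
open import Data.Fin.Base using (toℕ; fromℕ<)
open import Data.Fin.Properties using (toℕ<n; toℕ-fromℕ<)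
open import Data.Integer.Base using (+_; -[1+_])
open import Data.List.Base using (List; []; _∷_; _++_; map; foldr; length; applyUpTo; [_])
open import Data.List.Properties using (foldr-++; applyUpTo-∷ʳ; map-applyUpTo; length-applyUpTo)
import Data.List.Membership.Setoid as Membership
import Data.List.Membership.Setoid.Properties as MembershipProperties
open import Data.List.Relation.Binary.Pointwise using (Pointwise; []; _∷_)
import Data.List.Relation.Binary.Permutation.Setoid as Permutation
import Data.List.Relation.Binary.Permutation.Setoid.Properties as PermutationProperties
open import Data.List.Relation.Unary.All.Properties using (All¬⇒¬Any)
open import Data.List.Relation.Unary.AllPairs as AllPairs using (_∷_)
open import Data.List.Relation.Unary.Any as Any using (here; there)
import Data.List.Relation.Unary.Unique.Setoid as Uniqueness
open Uniqueness using (Unique)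
import Data.List.Relation.Unary.Unique.Setoid.Properties as UniqueProperties
open import Data.Nat.Base as ℕ using (ℕ; NonZero; zero; suc; _≤_; _<_; _∸_; z≤n; s≤s)
open import Data.Nat.Divisibility using (divides; >⇒∤)
import Data.Nat.Properties as ℕ
open import Data.Product.Base using (_×_; _,_; proj₁; proj₂)
open import Data.Sum.Base using ([_,_]′)
open import Function.Base using (_∘_)
open import Function.Bundles using (module Equivalence)
open import Relation.Binary.Bundles using (Setoid)
open import Relation.Binary.Definitions using (tri<; tri≈; tri>)
open import Relation.Binary.PropositionalEquality.Core as ≡ using (_≡_)
open import Relation.Nullary using (¬_; Dec; yes; no; contradiction)
open import Relation.Nullary.Decidable using (map′; _⊎-dec_)
open import Relation.Unary using (_⊆_; _≐_; _∖_)

-- Formal power series and multiplication operators on them.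

module LinearFactors {c ℓ} (R : CommutativeRing c ℓ) where
  open CommutativeRing R
  open import Algebra.Definitions.RawSemiring (Semiring.rawSemiring semiring) using (_^_)
  open import Algebra.Properties.Ring ring using (-0#≈0#; -1*x≈-x; -‿distribˡ-*; -‿distribʳ-*; -‿involutive;
    x[y-z]≈xy-xz; xyx⁻¹≈y; x∙y⁻¹≈ε⇒x≈y; -‿+-comm)
  open import Algebra.Properties.CommutativeSemigroup +-commutativeSemigroup using (interchange)
  open import Relation.Binary.Reasoning.Setoid setoid
  open import Algebra.Properties.CommutativeSemigroup *-commutativeSemigroup
    using (x∙yz≈y∙xz)
    renaming (interchange to *-interchange)
  open Permutation setoid using (_↭_)

  -- The coefficients of a formal power series.
  Series : Set c
  Series = ℕ → Carrier

  infix 4 _≃_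
  _≃_ : Series → Series → Set ℓ
  f ≃ g = ∀ m → f m ≈ g m

  sum : List Carrier → Carrier
  sum = foldr _+_ 0#

  product : List Carrier → Carrier
  product = foldr _*_ 1#

  𝟏 : Series
  𝟏 zero    = 1#
  𝟏 (suc _) = 0#

  -- Multiplication by t.
  shift : Series → Series
  shift f zero    = 0#
  shift f (suc m) = f m

  -- Multiplication by 1 - x t.
  linear : Carrier → Series → Series
  linear x f m = f m - x * shift f m

  -- A product of factors 1 - x t is represented by the operator multiplying by it, and recovered by
  -- applying that operator to `𝟏`. No Cauchy product of series has to be defined.
  linears : List Carrier → Series → Series
  linears xs f = foldr linear f xs

  -- Multiplication by tⁿ.
  delay : ℕ → Series → Series
  delay zero    f = f
  delay (suc n) f = shift (delay n f)

  -- Multiplication by 1 - tⁿ.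
  binomial : ℕ → Series → Series
  binomial n f m = f m - delay n f m

  -‿cong₂ : ∀ {x y u v} → x ≈ y → u ≈ v → x - u ≈ y - v
  -‿cong₂ x≈y u≈v = +-cong x≈y (-‿cong u≈v)

  x-0≈x : ∀ x → x - 0# ≈ x
  x-0≈x x = trans (+-congˡ -0#≈0#) (+-identityʳ x)

  -‿interchange : ∀ a b c d → a - b - (c - d) ≈ a - c - (b - d)
  -‿interchange a b c d = begin
    a - b - (c - d)        ≈⟨ +-congˡ (-‿+-comm c (- d)) ⟨
    a - b + (- c - - d)    ≈⟨ interchange a (- b) (- c) (- - d) ⟩
    a - c + (- b - - d)    ≈⟨ +-congˡ (-‿+-comm b (- d)) ⟩
    a - c - (b - d)        ∎

  -x*-y≈x*y : ∀ x y → - x * - y ≈ x * y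
  -x*-y≈x*y x y = begin
    - x * - y    ≈⟨ -‿distribˡ-* x (- y) ⟨
    - (x * - y)  ≈⟨ -‿cong (-‿distribʳ-* x y) ⟨
    - - (x * y)  ≈⟨ -‿involutive (x * y) ⟩
    x * y        ∎

  -- Commutation and cancellation of linear factors.

  shift-cong : ∀ {f g} → f ≃ g → shift f ≃ shift g
  shift-cong f≃g zero    = refl
  shift-cong f≃g (suc m) = f≃g m

  linear-cong : ∀ {x y f g} → x ≈ y → f ≃ g → linear x f ≃ linear y g
  linear-cong x≈y f≃g m = -‿cong₂ (f≃g m) (*-cong x≈y (shift-cong f≃g m))

  linear-0 : ∀ x f → linear x f 0 ≈ f 0
  linear-0 x f = trans (-‿cong₂ refl (zeroʳ x)) (x-0≈x (f 0))

  shift-linear : ∀ x f → shift (linear x f) ≃ linear x (shift f)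
  shift-linear x f zero    = sym (linear-0 x (shift f))
  shift-linear x f (suc m) = refl

  -- Both sides expand to the same constant, linear and quadratic terms in t; `-‿interchange` swaps
  -- the two linear terms.
  linear-comm : ∀ x y f → linear x (linear y f) ≃ linear y (linear x f)
  linear-comm x y f m = begin
    linear y f m - x * shift (linear y f) m
      ≈⟨ -‿cong₂ refl (*-congˡ (shift-linear y f m)) ⟩
    f m - y * shift f m - x * (shift f m - y * shift (shift f) m)
      ≈⟨ -‿cong₂ refl (x[y-z]≈xy-xz x _ _) ⟩
    f m - y * shift f m - (x * shift f m - x * (y * shift (shift f) m))
      ≈⟨ -‿interchange _ _ _ _ ⟩
    f m - x * shift f m - (y * shift f m - x * (y * shift (shift f) m))
      ≈⟨ -‿cong₂ refl (-‿cong₂ refl (x∙yz≈y∙xz x y _)) ⟩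
    f m - x * shift f m - (y * shift f m - y * (x * shift (shift f) m))
      ≈⟨ -‿cong₂ refl (x[y-z]≈xy-xz y _ _) ⟨
    f m - x * shift f m - y * (shift f m - x * shift (shift f) m)
      ≈⟨ -‿cong₂ refl (*-congˡ (shift-linear x f m)) ⟨
    linear x f m - y * shift (linear x f) m ∎

  -- Since 1 - x t has constant term 1, each coefficient of the argument is recovered from the image
  -- and the preceding coefficient.
  linear-injective : ∀ x {f g} → linear x f ≃ linear x g → f ≃ g
  linear-injective x {f} {g} eq zero = begin
    f 0           ≈⟨ linear-0 x f ⟨
    linear x f 0  ≈⟨ eq 0 ⟩
    linear x g 0  ≈⟨ linear-0 x g ⟩
    g 0           ∎
  linear-injective x {f} {g} eq (suc m) = begin
    f (suc m)                         ≈⟨ [a-b]+b≈a _ _ ⟨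
    linear x f (suc m) + x * f m      ≈⟨ +-cong (eq (suc m)) (*-congˡ (linear-injective x eq m)) ⟩
    linear x g (suc m) + x * g m      ≈⟨ [a-b]+b≈a _ _ ⟩
    g (suc m)                         ∎
    where
    [a-b]+b≈a : ∀ a b → a - b + b ≈ a
    [a-b]+b≈a a b = begin
      a - b + b      ≈⟨ +-assoc a (- b) b ⟩
      a + (- b + b)  ≈⟨ +-congˡ (-‿inverseˡ b) ⟩
      a + 0#         ≈⟨ +-identityʳ a ⟩
      a              ∎

  linears-cong : ∀ xs {f g} → f ≃ g → linears xs f ≃ linears xs g
  linears-cong []       f≃g = f≃g
  linears-cong (x ∷ xs) f≃g = linear-cong refl (linears-cong xs f≃g)

  linears-0 : ∀ xs f → linears xs f 0 ≈ f 0
  linears-0 []       f = refl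
  linears-0 (x ∷ xs) f = trans (linear-0 x (linears xs f)) (linears-0 xs f)

  linears-linear : ∀ xs y f → linears xs (linear y f) ≃ linear y (linears xs f)
  linears-linear []       y f m = refl
  linears-linear (x ∷ xs) y f m = trans
    (linear-cong refl (linears-linear xs y f) m)
    (linear-comm x y (linears xs f) m)

  linears-++ : ∀ xs ys f → linears (xs ++ ys) f ≡ linears xs (linears ys f)
  linears-++ xs ys f = foldr-++ linear f xs ys

  linears-comm : ∀ xs ys f → linears xs (linears ys f) ≃ linears ys (linears xs f)
  linears-comm xs []       f m = refl
  linears-comm xs (y ∷ ys) f m = trans
    (linears-linear xs y (linears ys f) m)
    (linear-cong refl (linears-comm xs ys f) m)

  linears-injective : ∀ xs {f g} → linears xs f ≃ linears xs g → f ≃ g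
  linears-injective []       eq = eq
  linears-injective (x ∷ xs) eq = linears-injective xs (linear-injective x eq)

  -- Factors commute, so the product depends only on the multiset of its roots. This allows the
  -- entries of a set and its complement to be traded for the powers of ζ.
  linears-↭ : ∀ {xs ys} f → xs ↭ ys → linears xs f ≃ linears ys f
  linears-↭ f (Permutation.refl xs≋ys) = go xs≋ys
    where
    go : ∀ {xs ys} → Pointwise _≈_ xs ys → linears xs f ≃ linears ys f
    go []             m = refl
    go (x≈y ∷ xs≋ys) m = linear-cong x≈y (go xs≋ys) m
  linears-↭ f (Permutation.prep x≈y xs↭ys) = linear-cong x≈y (linears-↭ f xs↭ys)
  linears-↭ f (Permutation.swap {ys = ys} {x′ = x′} {y′ = y′} x≈x′ y≈y′ xs↭ys) m = trans
    (linear-cong x≈x′ (linear-cong y≈y′ (linears-↭ f xs↭ys)) m)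
    (linear-comm x′ y′ (linears ys f) m)
  linears-↭ f (Permutation.trans xs↭ys ys↭zs) m =
    trans (linears-↭ f xs↭ys m) (linears-↭ f ys↭zs m)

  linears-𝟏-degree : ∀ xs {m} → length xs < m → linears xs 𝟏 m ≈ 0#
  linears-𝟏-degree []       {suc m} _         = refl
  linears-𝟏-degree (x ∷ xs) {suc m} (s≤s xs<m) = begin
    linears xs 𝟏 (suc m) - x * linears xs 𝟏 m
      ≈⟨ -‿cong₂ (linears-𝟏-degree xs (ℕ.m<n⇒m<1+n xs<m)) (*-congˡ (linears-𝟏-degree xs xs<m)) ⟩
    0# - x * 0#  ≈⟨ -‿cong₂ refl (zeroʳ x) ⟩
    0# - 0#      ≈⟨ x-0≈x 0# ⟩
    0#           ∎

  -- Multiplication by tⁿ and by 1 - tⁿ.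

  delay-cong : ∀ n {f g} → f ≃ g → delay n f ≃ delay n g
  delay-cong zero    f≃g = f≃g
  delay-cong (suc n) f≃g = shift-cong (delay-cong n f≃g)

  delay-≥ : ∀ {n m} f → n ≤ m → delay n f m ≡ f (m ∸ n)
  delay-≥ f z≤n       = ≡.refl
  delay-≥ f (s≤s n≤m) = delay-≥ f n≤m

  delay-< : ∀ {n m} f → m < n → delay n f m ≡ 0#
  delay-< {suc n} {zero}  f _         = ≡.refl
  delay-< {suc n} {suc m} f (s≤s m<n) = delay-< f m<n

  delay-linear : ∀ n x f → delay n (linear x f) ≃ linear x (delay n f)
  delay-linear zero    x f m = refl
  delay-linear (suc n) x f m =
    trans (shift-cong (delay-linear n x f) m) (shift-linear x (delay n f) m)

  binomial-cong : ∀ n {f g} → f ≃ g → binomial n f ≃ binomial n g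
  binomial-cong n f≃g m = -‿cong₂ (f≃g m) (delay-cong n f≃g m)

  binomial-linear : ∀ n x f → binomial n (linear x f) ≃ linear x (binomial n f)
  binomial-linear n x f m = begin
    linear x f m - delay n (linear x f) m
      ≈⟨ -‿cong₂ refl (delay-linear n x f m) ⟩
    f m - x * shift f m - (delay n f m - x * delay (suc n) f m)
      ≈⟨ -‿interchange _ _ _ _ ⟩
    f m - delay n f m - (x * shift f m - x * delay (suc n) f m)
      ≈⟨ -‿cong₂ refl (x[y-z]≈xy-xz x _ _) ⟨
    f m - delay n f m - x * (shift f m - delay (suc n) f m)
      ≈⟨ -‿cong₂ refl (*-congˡ (shift-binomial m)) ⟨
    linear x (binomial n f) m ∎
    where
    shift-binomial : ∀ m → shift (binomial n f) m ≈ shift f m - delay (suc n) f m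
    shift-binomial zero    = sym (x-0≈x 0#)
    shift-binomial (suc m) = refl

  binomial-linears : ∀ n xs f → binomial n (linears xs f) ≃ linears xs (binomial n f)
  binomial-linears n []       f m = refl
  binomial-linears n (x ∷ xs) f m = trans
    (binomial-linear n x (linears xs f) m)
    (linear-cong refl (binomial-linears n xs f) m)

  -- Generating functions of the symmetric polynomials.

  elementary complete : List Carrier → Series
  elementary xs m = sum (map product (increasing m xs))
  complete   xs m = sum (map product (nondecreasing m xs))

  -- The recursive clauses of `increasing` and `nondecreasing` both have this shape, so one
  -- computation serves both generating functions.
  sum-map-product : ∀ z xss yss → sum (map product (map (z ∷_) xss ++ yss)) ≈
    z * sum (map product xss) + sum (map product yss)
  sum-map-product z []         yss = begin
    sum (map product yss)           ≈⟨ +-identityˡ _ ⟨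
    0# + sum (map product yss)      ≈⟨ +-congʳ (zeroʳ z) ⟨
    z * 0# + sum (map product yss)  ∎
  sum-map-product z (xs ∷ xss) yss = begin
    z * product xs + sum (map product (map (z ∷_) xss ++ yss))
      ≈⟨ +-congˡ (sum-map-product z xss yss) ⟩
    z * product xs + (z * sum (map product xss) + sum (map product yss))
      ≈⟨ +-assoc _ _ _ ⟨
    z * product xs + z * sum (map product xss) + sum (map product yss)
      ≈⟨ +-congʳ (distribˡ z _ _) ⟨
    z * (product xs + sum (map product xss)) + sum (map product yss) ∎

  -- E(-t) = ∏ (1 - x t)
  elementary≈linears-𝟏 : ∀ xs m → elementary xs m ≈ (- 1#) ^ m * linears xs 𝟏 m
  elementary≈linears-𝟏 xs zero = begin
    1# + 0#              ≈⟨ +-identityʳ 1# ⟩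
    1#                   ≈⟨ linears-0 xs 𝟏 ⟨
    linears xs 𝟏 0       ≈⟨ *-identityˡ _ ⟨
    1# * linears xs 𝟏 0  ∎
  elementary≈linears-𝟏 [] (suc m) = sym (zeroʳ _)
  elementary≈linears-𝟏 (x ∷ xs) (suc m) = begin
    elementary (x ∷ xs) (suc m)
      ≈⟨ sum-map-product x (increasing m xs) (increasing (suc m) xs) ⟩
    x * elementary xs m + elementary xs (suc m)
      ≈⟨ +-cong (*-congˡ (elementary≈linears-𝟏 xs m)) (elementary≈linears-𝟏 xs (suc m)) ⟩
    x * (s * f m) + - 1# * s * f (suc m)
      ≈⟨ +-cong (x∙yz≈y∙xz x s (f m)) (*-congʳ (-1*x≈-x s)) ⟩
    s * (x * f m) + - s * f (suc m)
      ≈⟨ +-comm _ _ ⟩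
    - s * f (suc m) + s * (x * f m)
      ≈⟨ +-congˡ (-x*-y≈x*y s (x * f m)) ⟨
    - s * f (suc m) + - s * - (x * f m)
      ≈⟨ distribˡ (- s) _ _ ⟨
    - s * (f (suc m) - x * f m)
      ≈⟨ *-congʳ (-1*x≈-x s) ⟨
    - 1# * s * (f (suc m) - x * f m) ∎
    where
    s = (- 1#) ^ m
    f = linears xs 𝟏

  -- A nondecreasing tuple either starts with `x`, and its rest may use `x` again, or avoids `x`.
  -- Hence the series H of `x ∷ xs` is x t H plus the series of `xs`.
  linear-complete : ∀ x xs → linear x (complete (x ∷ xs)) ≃ complete xs
  linear-complete x xs zero    = linear-0 x (complete (x ∷ xs))
  linear-complete x xs (suc m) = begin
    complete (x ∷ xs) (suc m) - x * complete (x ∷ xs) m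
      ≈⟨ +-congʳ (sum-map-product x (nondecreasing m (x ∷ xs)) (nondecreasing (suc m) xs)) ⟩
    x * complete (x ∷ xs) m + complete xs (suc m) - x * complete (x ∷ xs) m
      ≈⟨ xyx⁻¹≈y _ _ ⟩
    complete xs (suc m) ∎

  -- H(t) = ∏ (1 - x t)⁻¹
  linears-complete : ∀ xs → linears xs (complete xs) ≃ 𝟏
  linears-complete []       zero    = +-identityʳ 1#
  linears-complete []       (suc m) = refl
  linears-complete (x ∷ xs) m = begin
    -- The factor of `x` is moved inwards, next to the series whose `x`-part it cancels.
    linear x (linears xs (complete (x ∷ xs))) m  ≈⟨ linears-linear xs x _ m ⟨
    linears xs (linear x (complete (x ∷ xs))) m  ≈⟨ linears-cong xs (linear-complete x xs) m ⟩
    linears xs (complete xs) m                   ≈⟨ linears-complete xs m ⟩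
    𝟏 m                                          ∎

  -- Multiplication by ∏ (1 - y t) is injective, so both sides may be compared after it.
  linears-𝟏-complement : ∀ n xs ys → linears (xs ++ ys) 𝟏 ≃ binomial n 𝟏 →
    linears xs 𝟏 ≃ binomial n (complete ys)
  linears-𝟏-complement n xs ys eq = linears-injective ys λ m → begin
    linears ys (linears xs 𝟏) m             ≈⟨ linears-comm ys xs 𝟏 m ⟩
    linears xs (linears ys 𝟏) m             ≡⟨ ≡.cong (λ f → f m) (linears-++ xs ys 𝟏) ⟨
    linears (xs ++ ys) 𝟏 m                  ≈⟨ eq m ⟩
    binomial n 𝟏 m                          ≈⟨ binomial-cong n (linears-complete ys) m ⟨
    binomial n (linears ys (complete ys)) m ≈⟨ binomial-linears n ys (complete ys) m ⟩
    linears ys (binomial n (complete ys)) m ∎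

  -- The product over the powers of a root of unity.

  -- The substitution t ↦ q t.
  dilate : Carrier → Series → Series
  dilate q f m = q ^ m * f m

  dilate-linear : ∀ q x f → dilate q (linear x f) ≃ linear (q * x) (dilate q f)
  dilate-linear q x f zero = begin
    1# * linear x f 0              ≈⟨ *-congˡ (linear-0 x f) ⟩
    1# * f 0                       ≈⟨ linear-0 (q * x) (dilate q f) ⟨
    linear (q * x) (dilate q f) 0  ∎
  dilate-linear q x f (suc m) = begin
    q * q ^ m * (f (suc m) - x * f m)
      ≈⟨ x[y-z]≈xy-xz (q * q ^ m) _ _ ⟩
    q * q ^ m * f (suc m) - q * q ^ m * (x * f m)
      ≈⟨ -‿cong₂ refl (*-interchange q (q ^ m) x (f m)) ⟩
    q * q ^ m * f (suc m) - q * x * (q ^ m * f m) ∎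

  dilate-linears : ∀ q xs f → dilate q (linears xs f) ≃ linears (map (q *_) xs) (dilate q f)
  dilate-linears q []       f m = refl
  dilate-linears q (x ∷ xs) f m = trans
    (dilate-linear q x (linears xs f) m)
    (linear-cong refl (dilate-linears q xs f) m)

  dilate-𝟏 : ∀ q → dilate q 𝟏 ≃ 𝟏
  dilate-𝟏 q zero    = *-identityˡ 1#
  dilate-𝟏 q (suc m) = zeroʳ _

  powers : Carrier → ℕ → List Carrier
  powers q = applyUpTo (q ^_)

  -- Multiplied by 1 - t, both sides are (1 - t)(1 - q t) ⋯ (1 - qⁿ t).
  dilate-powers : ∀ q n → q ^ n ≈ 1# → dilate q (linears (powers q n) 𝟏) ≃ linears (powers q n) 𝟏
  dilate-powers q n qⁿ≈1 = linear-injective 1# λ m → begin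
    linear 1# (dilate q (linears (powers q n) 𝟏)) m
      ≈⟨ linear-cong refl (dilate-linears q (powers q n) 𝟏) m ⟩
    linear 1# (linears (map (q *_) (powers q n)) (dilate q 𝟏)) m
      ≈⟨ linear-cong refl (linears-cong (map (q *_) (powers q n)) (dilate-𝟏 q)) m ⟩
    linear 1# (linears (map (q *_) (powers q n)) 𝟏) m
      -- Multiplication by `q` raises every exponent by one, and the extra factor 1 - t contributes
      -- the missing exponent 0.
      ≡⟨ ≡.cong (λ xs → linears (1# ∷ xs) 𝟏 m) (map-applyUpTo (q ^_) (q *_) n) ⟩
    linears (powers q (suc n)) 𝟏 m
      ≡⟨ ≡.cong (λ xs → linears xs 𝟏 m) (applyUpTo-∷ʳ (q ^_) n) ⟨
    linears (powers q n ++ [ q ^ n ]) 𝟏 m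
      ≡⟨ ≡.cong (λ f → f m) (linears-++ (powers q n) [ q ^ n ] 𝟏) ⟩
    linears (powers q n) (linear (q ^ n) 𝟏) m
      ≈⟨ linears-linear (powers q n) (q ^ n) 𝟏 m ⟩
    linear (q ^ n) (linears (powers q n) 𝟏) m
      -- Since qⁿ = 1, the last factor is again 1 - t.
      ≈⟨ linear-cong qⁿ≈1 (λ _ → refl) m ⟩
    linear 1# (linears (powers q n) 𝟏) m ∎

  -- The fixed-point hypothesis says that `q ^ k - 1#` is not a zero divisor for 0 < k < n, a form
  -- that makes sense over any commutative ring.
  linears-powers : ∀ q n .{{_ : ℕ.NonZero n}} → q ^ n ≈ 1# →
    (∀ {k} → 0 < k → k < n → ∀ {x} → q ^ k * x ≈ x → x ≈ 0#) →
    linears (powers q n) 𝟏 ≃ binomial n 𝟏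
  linears-powers q n@(suc n-1) qⁿ≈1 fixed⇒0 = main
    where
    tail = applyUpTo (λ k → q ^ suc k) n-1
    P = linears (powers q n) 𝟏
    Q = linears tail 𝟏

    -- P is invariant under t ↦ q t, so its middle coefficients vanish.
    P-middle : ∀ {k} → 0 < k → k < n → P k ≈ 0#
    P-middle {k} 0<k k<n = fixed⇒0 0<k k<n (dilate-powers q n qⁿ≈1 k)

    -- P = (1 - t) Q, so the coefficients of Q are the partial sums of those of P.
    Q≈1 : ∀ k → k < n → Q k ≈ 1#
    Q≈1 zero    _     = linears-0 tail 𝟏
    Q≈1 (suc k) 1+k<n = begin
      -- The head of `powers q n` is `q ^ 0`, so `P (suc k)` unfolds to `Q (suc k) - 1# * Q k`.
      Q (suc k)              ≈⟨ x∙y⁻¹≈ε⇒x≈y _ _ (P-middle ℕ.z<s 1+k<n) ⟩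
      1# * Q k               ≈⟨ *-identityˡ _ ⟩
      Q k                    ≈⟨ Q≈1 k (ℕ.<-trans (ℕ.n<1+n k) 1+k<n) ⟩
      1#                     ∎

    Qn≈0 : Q n ≈ 0#
    -- Q has only n - 1 linear factors.
    Qn≈0 = linears-𝟏-degree tail (s≤s (ℕ.≤-reflexive (length-applyUpTo (λ k → q ^ suc k) n-1)))

    main : P ≃ binomial n 𝟏
    main zero = begin
      P 0        ≈⟨ linears-0 (powers q n) 𝟏 ⟩
      1#         ≈⟨ x-0≈x 1# ⟨
      1# - 0#    ∎
    main m@(suc m-1) with ℕ.<-cmp m n
    ... | tri< m<n _ _ = begin
      P m                 ≈⟨ P-middle ℕ.z<s m<n ⟩
      0#                  ≈⟨ x-0≈x 0# ⟨
      0# - 0#             ≡⟨ ≡.cong (_-_ 0#) (delay-< 𝟏 m<n) ⟨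
      0# - delay n 𝟏 m    ∎
    ... | tri≈ _ ≡.refl _ = begin
      -- The coefficient of tⁿ in (1 - t) Q is Q n - Q (n - 1) = 0 - 1.
      Q m - 1# * Q m-1    ≈⟨ -‿cong₂ Qn≈0 (trans (*-identityˡ _) (Q≈1 m-1 ℕ.≤-refl)) ⟩
      0# - 𝟏 0            ≡⟨ ≡.cong (λ k → 0# - 𝟏 k) (ℕ.n∸n≡0 n) ⟨
      0# - 𝟏 (m ∸ n)      ≡⟨ ≡.cong (_-_ 0#) (delay-≥ 𝟏 (ℕ.≤-refl {n})) ⟨
      0# - delay n 𝟏 m    ∎
    ... | tri> _ _ m>n = begin
      P m                 ≈⟨ linears-𝟏-degree (powers q n) |powers|<m ⟩
      0#                  ≈⟨ x-0≈x 0# ⟨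
      -- As m > n, the index `m ∸ n` is a successor, where `𝟏` vanishes.
      0# - 0#             ≡⟨ ≡.cong (λ k → 0# - 𝟏 k) (ℕ.suc-pred (m ∸ n) {{ℕ.>-nonZero (ℕ.m<n⇒0<n∸m m>n)}}) ⟩
      0# - 𝟏 (m ∸ n)      ≡⟨ ≡.cong (_-_ 0#) (delay-≥ 𝟏 (ℕ.<⇒≤ m>n)) ⟨
      0# - delay n 𝟏 m    ∎
      where
      |powers|<m : length (powers q n) < m
      |powers|<m = ≡.subst (_< m) (≡.sym (length-applyUpTo (q ^_) n)) m>n

-- Enumerations of the same set.

-- Each entry of `xs` is located in `ys` by its membership proof, moved to the front and cancelled,
-- without deciding equality.
unique⇒↭ : ∀ {a ℓ} (S : Setoid a ℓ) (let open Membership S using (_∈_)) {xs ys} →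
  Unique S xs → Unique S ys →
  (∀ {z} → z ∈ xs → z ∈ ys) → (∀ {z} → z ∈ ys → z ∈ xs) →
  Permutation._↭_ S xs ys
unique⇒↭ S {ys = ys} = go ys
  where
  open Setoid S using (_≈_; refl; sym; trans)
  open Membership S using (_∈_)
  open Permutation S using (_↭_; ↭-refl; ↭-sym; ↭-trans; ↭-prep; ↭-reflexive-≋)
  open PermutationProperties S using (shift; ∈-resp-↭; Unique-resp-↭)

  -- By distinctness no entry of `xs` equals `x`, so its membership on the right must lie in the
  -- tail.
  ∷-cancel-⊆ : ∀ {x xs ys} → Unique S (x ∷ xs) →
    (∀ {z} → z ∈ x ∷ xs → z ∈ x ∷ ys) → ∀ {z} → z ∈ xs → z ∈ ys
  ∷-cancel-⊆ (x∉xs ∷ _) ⊆ z∈xs with ⊆ (there z∈xs)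
  ... | here z≈x   = contradiction (MembershipProperties.∈-resp-≈ S z≈x z∈xs) (All¬⇒¬Any x∉xs)
  ... | there z∈ys = z∈ys

  go : ∀ ys {xs} → Unique S xs → Unique S ys →
    (∀ {z} → z ∈ xs → z ∈ ys) → (∀ {z} → z ∈ ys → z ∈ xs) → xs ↭ ys
  go []      {[]}     _   _   _ _ = ↭-refl
  go (_ ∷ _) {[]}     _   _   _ ⊇ with () ← ⊇ (here refl)
  go ys      {x ∷ xs} xs! ys! ⊆ ⊇
    with ys₁ , ys₂ , w , x≈w , ys≋ ← MembershipProperties.∈-∃++ S (⊆ (here refl)) =
    ↭-trans (↭-prep x (go (ys₁ ++ ys₂) (AllPairs.tail xs!) (AllPairs.tail zs!)
      (∷-cancel-⊆ xs! (λ z∈ → ∈-resp-↭ ys↭ (⊆ z∈)))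
      (∷-cancel-⊆ zs! (λ z∈ → ⊇ (∈-resp-↭ (↭-sym ys↭) z∈)))))
      (↭-sym ys↭)
    where
    ys↭ : ys ↭ x ∷ ys₁ ++ ys₂
    ys↭ = ↭-trans (↭-reflexive-≋ ys≋) (shift (sym x≈w) ys₁ ys₂)
    zs! = Unique-resp-↭ ys↭ ys!

-- Roots of unity, beginning with cancellation in characteristic zero.

module RootsOfUnity {c ℓ₁ ℓ₂} (ℂ : ComplexNumbers c ℓ₁ ℓ₂) where
  open ComplexNumbers ℂ
  open Symmetric ℂ
  open CommutativeRing commutativeRing using (ring; semiring; +-monoid; +-commutativeMonoid)
  open import Algebra.Properties.Monoid.Mult +-monoid
    using (×-congʳ; ×-homo-+; ×-homo-1; ×-assocˡ; ×-idem)
  open import Algebra.Properties.CommutativeMonoid.Mult +-commutativeMonoid using (×-distrib-+)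
  open import Algebra.Properties.Semiring.Mult semiring using (×-assoc-*; ×-comm-*)
  open import Algebra.Properties.Semiring.Exp semiring using (^-homo-*)
  open import Algebra.Properties.Ring ring using
    (+-cancelˡ; -0#≈0#; -1*x≈-x; -‿distribˡ-*; -‿involutive; x[y-z]≈xy-xz; x∙y⁻¹≈ε⇒x≈y)
  open import Relation.Binary.Reasoning.Setoid setoid
  open Membership setoid using (_∈_)
  open Uniqueness setoid using () renaming (Unique to Distinct)
  open LinearFactors commutativeRing hiding (sum; product)

  x#0∧xy≈0⇒y≈0 : ∀ {x y} → x # 0# → x * y ≈ 0# → y ≈ 0#
  x#0∧xy≈0⇒y≈0 {x} {y} x#0 xy≈0 with x⁻¹ , x⁻¹x≈1 , _ ← #⇒invertible x#0 = begin
    y                     ≈⟨ *-identityˡ y ⟨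
    1# * y                ≈⟨ *-congʳ x⁻¹x≈1 ⟨
    -- `#⇒invertible` provides an inverse of the difference `x - 0#`, not of `x` itself.
    x⁻¹ * (x - 0#) * y    ≈⟨ *-congʳ (*-congˡ (x-0≈x x)) ⟩
    x⁻¹ * x * y           ≈⟨ *-assoc x⁻¹ x y ⟩
    x⁻¹ * (x * y)         ≈⟨ *-congˡ xy≈0 ⟩
    x⁻¹ * 0#              ≈⟨ zeroʳ x⁻¹ ⟩
    0#                    ∎

  -- From `¬ q ≈ 1#` alone no inverse of `q - 1#` is available. By tightness it suffices to refute
  -- `x # 0#`, and then `x` can be cancelled instead, giving q = 1.
  fixed⇒0 : ∀ {q x} → ¬ q ≈ 1# → q * x ≈ x → x ≈ 0#
  fixed⇒0 {q} {x} q≉1 qx≈x = proj₁ (tight x 0#) λ x#0 →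
    q≉1 (x∙y⁻¹≈ε⇒x≈y q 1# (x#0∧xy≈0⇒y≈0 x#0 (begin
      x * (q - 1#)      ≈⟨ x[y-z]≈xy-xz x q 1# ⟩
      x * q - x * 1#    ≈⟨ -‿cong₂ (trans (*-comm x q) qx≈x) (*-identityʳ x) ⟩
      x - x             ≈⟨ -‿inverseʳ x ⟩
      0#                ∎)))

  ×ℕ-torsionFree : ∀ n .{{_ : NonZero n}} {x} → n ×ℕ x ≈ 0# → x ≈ 0#
  ×ℕ-torsionFree n {x} nx≈0 = x#0∧xy≈0⇒y≈0 (char0 n) (begin
    (n ×ℕ 1#) * x   ≈⟨ ×-assoc-* n 1# x ⟩
    n ×ℕ (1# * x)   ≈⟨ ×-congʳ n (*-identityˡ x) ⟩
    n ×ℕ x          ≈⟨ nx≈0 ⟩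
    0#              ∎)

  ×ℕ-injective : ∀ {x} → ¬ x ≈ 0# → ∀ m n → m ×ℕ x ≈ n ×ℕ x → m ≡ n
  ×ℕ-injective x≉0 zero    zero    _  = ≡.refl
  ×ℕ-injective x≉0 zero    (suc n) eq = contradiction (×ℕ-torsionFree (suc n) (sym eq)) x≉0
  ×ℕ-injective x≉0 (suc m) zero    eq = contradiction (×ℕ-torsionFree (suc m) eq) x≉0
  ×ℕ-injective x≉0 (suc m) (suc n) eq = ≡.cong suc (×ℕ-injective x≉0 m n (+-cancelˡ _ _ _ eq))

  1≉0 : ¬ 1# ≈ 0#
  1≉0 1≈0 = proj₂ (tight (1 ×ℕ 1#) 0#) (trans (×-homo-1 1#) 1≈0) (char0 1)

  -- Otherwise characteristic zero and `π#0` force i = 0, so i² = -1 gives 1 = 0.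
  2πi≉0 : ¬ 2πi ≈ 0#
  2πi≉0 2πi≈0 = 1≉0 (begin
    1#          ≈⟨ -‿involutive 1# ⟨
    - - 1#      ≈⟨ -‿cong i²≈-1 ⟨
    - (i * i)   ≈⟨ -‿cong (*-congʳ i≈0) ⟩
    - (0# * i)  ≈⟨ -‿cong (zeroˡ i) ⟩
    - 0#        ≈⟨ -0#≈0# ⟩
    0#          ∎)
    where
    i≈0 : i ≈ 0#
    i≈0 = x#0∧xy≈0⇒y≈0 π#0 (×ℕ-torsionFree 2 2πi≈0)

  -- The order of ζ.

  module _ (n : ℕ) .{{_ : NonZero n}} where

    n×2πi/n≈2πi : n ×ℕ (2πi * 1/ n) ≈ 2πi
    n×2πi/n≈2πi = begin
      n ×ℕ (2πi * 1/ n)           ≈⟨ ×-comm-* n 2πi (1/ n) ⟨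
      2πi * (n ×ℕ 1/ n)           ≈⟨ *-congˡ (×-congʳ n (*-identityˡ (1/ n))) ⟨
      2πi * (n ×ℕ (1# * 1/ n))    ≈⟨ *-congˡ (×-assoc-* n 1# (1/ n)) ⟨
      2πi * ((n ×ℕ 1#) * 1/ n)    ≈⟨ *-congˡ (*-congʳ (x-0≈x _)) ⟨
      2πi * ((n ×ℕ 1# - 0#) * 1/ n)
        ≈⟨ *-congˡ (proj₂ (proj₂ (#⇒invertible (char0 n)))) ⟩
      2πi * 1#                    ≈⟨ *-identityʳ 2πi ⟩
      2πi                         ∎

    ζ^≈exp : ∀ d → ζ n ^ d ≈ exp (d ×ℕ (2πi * 1/ n))
    -- The value exp 0 = 1 comes from the kernel condition with k = 0.
    ζ^≈exp zero    = sym (Equivalence.from (exp-kernel 0#) (+ 0 , refl))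
    ζ^≈exp (suc d) = trans (*-congˡ (ζ^≈exp d)) (sym (exp-+ _ _))

    ζ^n≈1 : ζ n ^ n ≈ 1#
    ζ^n≈1 = trans (ζ^≈exp n) (Equivalence.from (exp-kernel _)
      (+ 1 , trans n×2πi/n≈2πi (sym (×-homo-1 2πi))))

    -- If ζ^d = 1, the kernel of exp yields an integer k with d = n k, impossible for 0 < d < n.
    ζ^≉1 : ∀ {d} → 0 < d → d < n → ¬ ζ n ^ d ≈ 1#
    ζ^≉1 {d} 0<d d<n ζ^d≈1
      with k , eq ← Equivalence.to (exp-kernel _) (trans (sym (ζ^≈exp d)) ζ^d≈1) =
      absurd k (begin
        d ×ℕ 2πi                       ≈⟨ ×-congʳ d n×2πi/n≈2πi ⟨
        d ×ℕ (n ×ℕ (2πi * 1/ n))       ≈⟨ ×-assocˡ _ d n ⟩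
        (d ℕ.* n) ×ℕ (2πi * 1/ n)      ≡⟨ ≡.cong (_×ℕ (2πi * 1/ n)) (ℕ.*-comm d n) ⟩
        (n ℕ.* d) ×ℕ (2πi * 1/ n)      ≈⟨ ×-assocˡ _ n d ⟨
        n ×ℕ (d ×ℕ (2πi * 1/ n))       ≈⟨ ×-congʳ n eq ⟩
        n ×ℕ (k ×ℤ 2πi)                ∎)
      where
      absurd : ∀ k → ¬ d ×ℕ 2πi ≈ n ×ℕ (k ×ℤ 2πi)
      absurd (+ j) eq = >⇒∤ {{ℕ.>-nonZero 0<d}} d<n (divides j (≡.trans
        (×ℕ-injective 2πi≉0 d (n ℕ.* j) (trans eq (×-assocˡ 2πi n j)))
        (ℕ.*-comm n j)))
      -- For negative k, moving everything to one side makes the positive multiple d + n (j + 1) of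
      -- 2πi vanish.
      absurd -[1+ j ] eq = 2πi≉0 (×ℕ-torsionFree (d ℕ.+ n ℕ.* suc j)
        {{ℕ.>-nonZero (ℕ.<-≤-trans 0<d (ℕ.m≤m+n d _))}} (begin
          (d ℕ.+ n ℕ.* suc j) ×ℕ 2πi
            ≈⟨ ×-homo-+ 2πi d _ ⟩
          d ×ℕ 2πi + (n ℕ.* suc j) ×ℕ 2πi
            ≈⟨ +-cong eq (sym (×-assocˡ 2πi n (suc j))) ⟩
          n ×ℕ (- (suc j ×ℕ 2πi)) + n ×ℕ (suc j ×ℕ 2πi)
            ≈⟨ ×-distrib-+ _ _ n ⟨
          n ×ℕ (- (suc j ×ℕ 2πi) + suc j ×ℕ 2πi)
            ≈⟨ ×-congʳ n (-‿inverseˡ _) ⟩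
          n ×ℕ 0#
            ≈⟨ ×-idem (+-identityˡ 0#) n ⟩
          0# ∎))

    -- Multiplying by ζ^(n - k), rather than dividing by ζ^j, gives ζ^(n - k + j) = 1 with exponent
    -- strictly between 0 and n.
    ζ^-injective : ∀ {j k} → j < k → k < n → ¬ ζ n ^ j ≈ ζ n ^ k
    ζ^-injective {j} {k} j<k k<n eq = ζ^≉1 0<d d<n (begin
      ζ n ^ (n ∸ k ℕ.+ j)          ≈⟨ ^-homo-* (ζ n) (n ∸ k) j ⟩
      ζ n ^ (n ∸ k) * ζ n ^ j      ≈⟨ *-congˡ eq ⟩
      ζ n ^ (n ∸ k) * ζ n ^ k      ≈⟨ ^-homo-* (ζ n) (n ∸ k) k ⟨
      ζ n ^ (n ∸ k ℕ.+ k)          ≡⟨ ≡.cong (ζ n ^_) n∸k+k≡n ⟩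
      ζ n ^ n                      ≈⟨ ζ^n≈1 ⟩
      1#                           ∎)
      where
      n∸k+k≡n = ℕ.m∸n+n≡m (ℕ.<⇒≤ k<n)
      0<d : 0 < n ∸ k ℕ.+ j
      0<d = ℕ.<-≤-trans (ℕ.m<n⇒0<n∸m k<n) (ℕ.m≤m+n (n ∸ k) j)
      d<n : n ∸ k ℕ.+ j < n
      d<n = ℕ.<-≤-trans (ℕ.+-monoʳ-< (n ∸ k) j<k) (ℕ.≤-reflexive n∸k+k≡n)

    -- The enumeration of the roots and decidable membership.

    roots : List Carrier
    roots = powers (ζ n) n

    roots-distinct : Distinct roots
    roots-distinct = UniqueProperties.applyUpTo⁺₁ setoid (ζ n ^_) n ζ^-injective

    𝒵⇒∈-roots : ∀ {z} → 𝒵 n z → z ∈ roots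
    𝒵⇒∈-roots (k , z≈ζ^k) = MembershipProperties.∈-resp-≈ setoid (sym z≈ζ^k)
      (MembershipProperties.∈-applyUpTo⁺ setoid (ζ n ^_) (toℕ<n k))

    ∈-roots⇒𝒵 : ∀ {z} → z ∈ roots → 𝒵 n z
    ∈-roots⇒𝒵 z∈roots
      with k , k<n , z≈ζ^k ← MembershipProperties.∈-applyUpTo⁻ setoid (ζ n ^_) z∈roots =
      fromℕ< k<n , trans z≈ζ^k (reflexive (≡.cong (ζ n ^_) (≡.sym (toℕ-fromℕ< k<n))))

    -- Equality in the field is not assumed decidable, but between roots of unity it amounts to
    -- equality of exponents below n.
    𝒵-≈? : ∀ {z w} → 𝒵 n z → 𝒵 n w → Dec (z ≈ w)
    𝒵-≈? (j , z≈ζ^j) (k , w≈ζ^k) with ℕ.<-cmp (toℕ j) (toℕ k)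
    ... | tri≈ _ j≡k _ = yes (trans z≈ζ^j (trans (reflexive (≡.cong (ζ n ^_) j≡k)) (sym w≈ζ^k)))
    ... | tri< j<k _ _ = no λ z≈w → ζ^-injective j<k (toℕ<n k) (trans (sym z≈ζ^j) (trans z≈w w≈ζ^k))
    ... | tri> _ _ j>k = no λ z≈w → ζ^-injective j>k (toℕ<n j) (trans (sym w≈ζ^k) (trans (sym z≈w) z≈ζ^j))

    𝒵-∈? : ∀ xs → (∀ {x} → x ∈ xs → 𝒵 n x) → ∀ {z} → 𝒵 n z → Dec (z ∈ xs)
    𝒵-∈? []       _    _   = no λ ()
    𝒵-∈? (x ∷ xs) xs⊆𝒵 z∈𝒵 = map′ Any.fromSum Any.toSum
      (𝒵-≈? z∈𝒵 (xs⊆𝒵 (here refl)) ⊎-dec 𝒵-∈? xs (xs⊆𝒵 ∘ there) z∈𝒵)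

    -- The product over all roots and the comparison of coefficients.

    linears-roots : linears roots 𝟏 ≃ binomial n 𝟏
    linears-roots = linears-powers (ζ n) n ζ^n≈1 λ 0<k k<n → fixed⇒0 (ζ^≉1 0<k k<n)

    -- The two lists are disjoint, so their concatenation has no repetition; deciding membership in
    -- `J` shows that it covers `𝒵 n`.
    complement-↭ : (J : FiniteSet) → ⟦ J ⟧ ⊆ 𝒵 n →
      (Jᶜ : FiniteSet) → ⟦ Jᶜ ⟧ ≐ (𝒵 n ∖ ⟦ J ⟧) →
      Permutation._↭_ setoid (elements J ++ elements Jᶜ) roots
    complement-↭ J J⊆𝒵 Jᶜ (Jᶜ⊆ , Jᶜ⊇) = unique⇒↭ setoid
      (UniqueProperties.++⁺ setoid (distinct J) (distinct Jᶜ)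
        λ (z∈J , z∈Jᶜ) → proj₂ (Jᶜ⊆ z∈Jᶜ) z∈J)
      roots-distinct
      (λ z∈ → 𝒵⇒∈-roots ([ J⊆𝒵 , proj₁ ∘ Jᶜ⊆ ]′ (MembershipProperties.∈-++⁻ setoid (elements J) z∈)))
      λ z∈ → covered (∈-roots⇒𝒵 z∈)
      where
      covered : ∀ {z} → 𝒵 n z → z ∈ elements J ++ elements Jᶜ
      covered z∈𝒵 with 𝒵-∈? (elements J) J⊆𝒵 z∈𝒵
      ... | yes z∈J = MembershipProperties.∈-++⁺ˡ setoid z∈J
      ... | no  z∉J = MembershipProperties.∈-++⁺ʳ setoid (elements J) (Jᶜ⊇ (z∈𝒵 , z∉J))

    -- This compares coefficients in E_J(-t) = (1 - tⁿ) H(t), H belonging to the complement, before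
    -- the cases n ≤ m and m < n are separated.
    ℰ≈binomial-ℋ : (m : ℕ) (J : FiniteSet) → ⟦ J ⟧ ⊆ 𝒵 n →
      (Jᶜ : FiniteSet) → ⟦ Jᶜ ⟧ ≐ (𝒵 n ∖ ⟦ J ⟧) →
      ℰ m J ≈ (- 1#) ^ m * binomial n (λ k → ℋ k Jᶜ) m
    ℰ≈binomial-ℋ m J J⊆𝒵 Jᶜ Jᶜ≐ = trans
      (elementary≈linears-𝟏 (elements J) m)
      (*-congˡ (linears-𝟏-complement n (elements J) (elements Jᶜ)
        (λ k → trans (linears-↭ 𝟏 (complement-↭ J J⊆𝒵 Jᶜ Jᶜ≐) k) (linears-roots k)) m))

    -- Only m > 0 is possible here, so m ∸ 1 is not truncated.
    signed-binomial-≥ : ∀ {m} → n ≤ m → ∀ f →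
      (- 1#) ^ m * binomial n f m ≈ (- 1#) ^ m * f m + (- 1#) ^ (m ∸ 1) * f (m ∸ n)
    signed-binomial-≥ {zero}  n≤0 f = contradiction (ℕ.n≤0⇒n≡0 n≤0) (ℕ.≢-nonZero⁻¹ n)
    signed-binomial-≥ {suc m} n≤m f = begin
      - 1# * s * (f (suc m) - delay n f (suc m))
        ≡⟨ ≡.cong (λ x → - 1# * s * (f (suc m) - x)) (delay-≥ f n≤m) ⟩
      - 1# * s * (f (suc m) - f (suc m ∸ n))
        ≈⟨ x[y-z]≈xy-xz (- 1# * s) _ _ ⟩
      - 1# * s * f (suc m) - - 1# * s * f (suc m ∸ n)
        -- The minus sign of -tⁿ cancels one factor -1, which lowers the exponent of the sign to m -
        -- 1.
        ≈⟨ +-congˡ (begin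
          - (- 1# * s * f (suc m ∸ n))  ≈⟨ -‿cong (*-congʳ (-1*x≈-x s)) ⟩
          - (- s * f (suc m ∸ n))       ≈⟨ -‿distribˡ-* (- s) _ ⟩
          - - s * f (suc m ∸ n)         ≈⟨ *-congʳ (-‿involutive s) ⟩
          s * f (suc m ∸ n)             ∎) ⟩
      - 1# * s * f (suc m) + s * f (suc m ∸ n) ∎
      where s = (- 1#) ^ m

    signed-binomial-< : ∀ {m} → m < n → ∀ f → (- 1#) ^ m * binomial n f m ≈ (- 1#) ^ m * f m
    signed-binomial-< {m} m<n f = *-congˡ (begin
      f m - delay n f m  ≡⟨ ≡.cong (_-_ (f m)) (delay-< f m<n) ⟩
      f m - 0#           ≈⟨ x-0≈x (f m) ⟩
      f m                ∎)

-- A `FiniteSet` is an enumeration, so the complement enters as an arbitrary enumeration `Jᶜ` of the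
-- set difference.
corollary1p5 : ∀ {c ℓ₁ ℓ₂} (ℂ : ComplexNumbers c ℓ₁ ℓ₂) →
  let open ComplexNumbers ℂ
      open Symmetric ℂ in
  (n : ℕ) .{{_ : NonZero n}} (m : ℕ)
  (J : FiniteSet) → ⟦ J ⟧ ⊆ 𝒵 n →
  (Jᶜ : FiniteSet) → ⟦ Jᶜ ⟧ ≐ (𝒵 n ∖ ⟦ J ⟧) →
  (n ≤ m → ℰ m J ≈ (- 1#) ^ m * ℋ m Jᶜ + (- 1#) ^ (m ∸ 1) * ℋ (m ∸ n) Jᶜ)
  × (¬ (n ≤ m) → ℰ m J ≈ (- 1#) ^ m * ℋ m Jᶜ)
corollary1p5 ℂ n m J J⊆𝒵 Jᶜ Jᶜ≐ =
  (λ n≤m → trans ℰ≈ (signed-binomial-≥ n n≤m _)) , (λ n≰m → trans ℰ≈ (signed-binomial-< n (ℕ.≰⇒> n≰m) _))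
  where
  open ComplexNumbers ℂ using (trans)
  open RootsOfUnity ℂ
  ℰ≈ = ℰ≈binomial-ℋ n m J J⊆𝒵 Jᶜ Jᶜ≐
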